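{- $P\in T$.
   Context: Let $D$ be a positive integer and let $Q_D$ be the $D$-cube: the graph with vertex set $X=\{0,1\}^D$, two vertices being adjacent iff they differ in exactly one coordinate; $\partial$ denotes path-length distance. $\mathrm{Mat}_X(\mathbb{C})$ is the algebra of complex matrices with rows and columns indexed by $X$. Write $\mathbf{i}^2=-1$. Let $A$ be the adjacency matrix of $Q_D$. Fix $x=(0,0,\ldots,0)\in X$. Let $A^*$ be the diagonal matrix in $\mathrm{Mat}_X(\mathbb{C})$ with $(y,y)$-entry $D-2\partial(x,y)$ for $y\in X$ (the dual adjacency matrix). Let $T$ be the subalgebra of $\mathrm{Mat}_X(\mathbb{C})$ generated by $A$ and $A^*$ (the Terwilliger algebra). Let $P_1$ be the matrix with rows and columns indexed by $\{0,1\}$, with $(0,0)$-entry $1$, $(0,1)$-entry $1$, $(1,0)$-entry $-\mathbf{i}$, and $(1,1)$-entry $\mathbf{i}$. Let $P=P_1^{\otimes D}\in\mathrm{Mat}_X(\mathbb{C})$ be the $D$-fold Kronecker power, i.e. for $y=(y_1,\ldots,y_D)$ and $z=(z_1,\ldots,z_D)$ in $X$, $P_{yz}=\prod_{k=1}^D (P_1)_{y_kz_k}$. -}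

module Defs where

open import Algebra.Bundles using (CommutativeRing)
open import Data.Bool.Base using (if_then_else_)
open import Data.Fin.Base using (Fin; zero; suc)
import Data.Fin.Properties as Fin
open import Data.Integer.Base as ℤ using (ℤ; +_)
open import Data.Nat.Base as ℕ using (ℕ; zero; suc)
import Data.Nat.Properties as ℕ
open import Data.Product.Base using (∃; ∃-syntax; _×_; _,_; proj₁; proj₂)
open import Data.Product using (∃!)
open import Data.Rational.Base as ℚ using (ℚ; 0ℚ; 1ℚ; ½)
import Data.Rational.Properties as ℚ
open import Data.Rational.Solver using (module +-*-Solver)
open import Data.Vec.Base using (Vec; []; _∷_; lookup; replicate)
open import Data.Vec.Properties using (≡-dec)
open import Function.Base using (_∘_)
open import Level using (0ℓ)
open import Relation.Binary.Core using (Rel)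
open import Relation.Binary.Definitions using (Decidable)
open import Relation.Binary.PropositionalEquality
  using (_≡_; _≢_; refl; sym; trans; cong; cong₂; subst)
open import Relation.Nullary.Decidable
  using (Dec; yes; no; does; ¬?; map′; _×-dec_; _→-dec_)
open import Relation.Nullary.Negation.Core using (¬_; contradiction)
open import Relation.Unary using (Pred; _∪_; ｛_｝)

------------------------------------------------------------------------
-- Real numbers: Cauchy sequences of rationals (with a modulus, carried
-- by the ∃), identified when their difference tends to 0.

Cauchy : (ℕ → ℚ) → Set
Cauchy s = ∀ ε → 0ℚ ℚ.< ε →
  ∃[ N ] ∀ m n → N ℕ.≤ m → N ℕ.≤ n → ℚ.∣ s m ℚ.- s n ∣ ℚ.< ε

-- The arithmetic operations are pointwise, and their Cauchy proofs are
-- abstract.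
record ℝ : Set where
  no-eta-equality
  pattern
  constructor mkℝ
  field
    seq    : ℕ → ℚ
    cauchy : Cauchy seq

open ℝ public

infix 4 _≈ᴿ_

record _≈ᴿ_ (x y : ℝ) : Set where
  constructor mk≈
  field
    null : ∀ ε → 0ℚ ℚ.< ε →
      ∃[ N ] ∀ n → N ℕ.≤ n → ℚ.∣ seq x n ℚ.- seq y n ∣ ℚ.< ε

open _≈ᴿ_ public

private
  -- Families f of rationals on an index type I, where  E N i  says that
  -- i is beyond N.  Used with I = ℕ (for ≈ᴿ) and I = ℕ × ℕ (for Cauchy).
  module Families {I : Set} (E : ℕ → I → Set)
    (anti : ∀ {M N i} → M ℕ.≤ N → E N i → E M i) where

    Null Bounded : (I → ℚ) → Set
    Null f = ∀ ε → 0ℚ ℚ.< ε → ∃[ N ] ∀ i → E N i → ℚ.∣ f i ∣ ℚ.< ε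
    Bounded f =
      ∃[ B ] 0ℚ ℚ.< B × (∃[ N ] ∀ i → E N i → ℚ.∣ f i ∣ ℚ.≤ B)

    null-cong : ∀ {f g} → (∀ i → f i ≡ g i) → Null f → Null g
    null-cong f≡g nf ε ε>0 =
      let N , h = nf ε ε>0 in
      N , λ i e → subst (λ q → ℚ.∣ q ∣ ℚ.< ε) (f≡g i) (h i e)

    null-0 : ∀ {f} → (∀ i → f i ≡ 0ℚ) → Null f
    null-0 f≡0 ε ε>0 =
      0 , λ i _ → subst (λ q → ℚ.∣ q ∣ ℚ.< ε) (sym (f≡0 i)) ε>0

    null-neg : ∀ {f} → Null f → Null (λ i → ℚ.- f i)
    null-neg {f} nf ε ε>0 =
      let N , h = nf ε ε>0 in
      N , λ i e → subst (ℚ._< ε) (sym (ℚ.∣-p∣≡∣p∣ (f i))) (h i e)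

    null-+ : ∀ {f g} → Null f → Null g → Null (λ i → f i ℚ.+ g i)
    null-+ {f} {g} nf ng ε ε>0 = M ℕ.⊔ N , bound
      where
      δ = ½ ℚ.* ε
      δ>0 : 0ℚ ℚ.< δ
      δ>0 = subst (ℚ._< δ) (ℚ.*-zeroʳ ½) (ℚ.*-monoʳ-<-pos ½ ε>0)
      M = proj₁ (nf δ δ>0)
      N = proj₁ (ng δ δ>0)
      δ+δ≡ε : δ ℚ.+ δ ≡ ε
      δ+δ≡ε = trans (sym (ℚ.*-distribʳ-+ ε ½ ½)) (ℚ.*-identityˡ ε)
      open ℚ.≤-Reasoning
      bound : ∀ i → E (M ℕ.⊔ N) i → ℚ.∣ f i ℚ.+ g i ∣ ℚ.< ε
      bound i e = begin-strict
        ℚ.∣ f i ℚ.+ g i ∣         ≤⟨ ℚ.∣p+q∣≤∣p∣+∣q∣ (f i) (g i) ⟩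
        ℚ.∣ f i ∣ ℚ.+ ℚ.∣ g i ∣   <⟨ ℚ.+-mono-<
          (proj₂ (nf δ δ>0) i (anti (ℕ.m≤m⊔n M N) e))
          (proj₂ (ng δ δ>0) i (anti (ℕ.m≤n⊔m M N) e)) ⟩
        δ ℚ.+ δ                   ≡⟨ δ+δ≡ε ⟩
        ε                         ∎

    null-* : ∀ {f g} → Bounded f → Null g → Null (λ i → f i ℚ.* g i)
    null-* {f} {g} (B , B>0 , M , b) ng ε ε>0 = M ℕ.⊔ N , bound
      where
      instance
        B-pos : ℚ.Positive B
        B-pos = ℚ.positive B>0
        B-nonNeg : ℚ.NonNegative B
        B-nonNeg = ℚ.pos⇒nonNeg B
        B-nonZero : ℚ.NonZero B
        B-nonZero = ℚ.pos⇒nonZero B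
        1/B-pos : ℚ.Positive (ℚ.1/ B)
        1/B-pos = ℚ.1/pos⇒pos B
      δ = ℚ.1/ B ℚ.* ε
      δ>0 : 0ℚ ℚ.< δ
      δ>0 = subst (ℚ._< δ) (ℚ.*-zeroʳ (ℚ.1/ B)) (ℚ.*-monoʳ-<-pos (ℚ.1/ B) ε>0)
      N = proj₁ (ng δ δ>0)
      Bδ≡ε : B ℚ.* δ ≡ ε
      Bδ≡ε = trans (sym (ℚ.*-assoc B (ℚ.1/ B) ε))
        (trans (cong (ℚ._* ε) (ℚ.*-inverseʳ B)) (ℚ.*-identityˡ ε))
      open ℚ.≤-Reasoning
      bound : ∀ i → E (M ℕ.⊔ N) i → ℚ.∣ f i ℚ.* g i ∣ ℚ.< ε
      bound i e = begin-strict
        ℚ.∣ f i ℚ.* g i ∣         ≡⟨ ℚ.∣p*q∣≡∣p∣*∣q∣ (f i) (g i) ⟩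
        ℚ.∣ f i ∣ ℚ.* ℚ.∣ g i ∣   ≤⟨ ℚ.*-monoʳ-≤-nonNeg ℚ.∣ g i ∣
          {{ℚ.nonNegative (ℚ.0≤∣p∣ (g i))}} (b i (anti (ℕ.m≤m⊔n M N) e)) ⟩
        B ℚ.* ℚ.∣ g i ∣           <⟨ ℚ.*-monoʳ-<-pos B
          (proj₂ (ng δ δ>0) i (anti (ℕ.m≤n⊔m M N) e)) ⟩
        B ℚ.* δ                   ≡⟨ Bδ≡ε ⟩
        ε                         ∎

  module One = Families {ℕ} ℕ._≤_ ℕ.≤-trans
  module Two = Families {ℕ × ℕ}
    (λ N i → N ℕ.≤ proj₁ i × N ℕ.≤ proj₂ i)
    (λ M≤N e → ℕ.≤-trans M≤N (proj₁ e) , ℕ.≤-trans M≤N (proj₂ e))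

  Δ : (ℕ → ℚ) → ℕ × ℕ → ℚ
  Δ s i = s (proj₁ i) ℚ.- s (proj₂ i)

  toCauchy : ∀ s → Two.Null (Δ s) → Cauchy s
  toCauchy s h ε ε>0 =
    let N , b = h ε ε>0 in N , λ m n N≤m N≤n → b (m , n) (N≤m , N≤n)

  fromCauchy : ∀ x → Two.Null (Δ (seq x))
  fromCauchy x ε ε>0 =
    let N , b = cauchy x ε ε>0 in N , λ i e → b _ _ (proj₁ e) (proj₂ e)

  difference : ∀ {x y} → x ≈ᴿ y → One.Null (λ n → seq x n ℚ.- seq y n)
  difference = null

  bounded : ∀ x → ∃[ B ] 0ℚ ℚ.< B ×
    (∃[ N ] ∀ n → N ℕ.≤ n → ℚ.∣ seq x n ∣ ℚ.≤ B)
  bounded x = B , B>0 , N , bound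
    where
    1>0 : 0ℚ ℚ.< 1ℚ
    1>0 = ℚ.positive⁻¹ 1ℚ
    N = proj₁ (cauchy x 1ℚ 1>0)
    B = 1ℚ ℚ.+ ℚ.∣ seq x N ∣
    B>0 : 0ℚ ℚ.< B
    B>0 = ℚ.+-mono-<-≤ 1>0 (ℚ.0≤∣p∣ (seq x N))
    open ℚ.≤-Reasoning
    open +-*-Solver
    bound : ∀ n → N ℕ.≤ n → ℚ.∣ seq x n ∣ ℚ.≤ B
    bound n N≤n = begin
      ℚ.∣ seq x n ∣
        ≡⟨ cong ℚ.∣_∣ (solve 2 (λ a b → a := (a :- b) :+ b) refl (seq x n) (seq x N)) ⟩
      ℚ.∣ (seq x n ℚ.- seq x N) ℚ.+ seq x N ∣
        ≤⟨ ℚ.∣p+q∣≤∣p∣+∣q∣ (seq x n ℚ.- seq x N) (seq x N) ⟩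
      ℚ.∣ seq x n ℚ.- seq x N ∣ ℚ.+ ℚ.∣ seq x N ∣
        ≤⟨ ℚ.+-monoˡ-≤ ℚ.∣ seq x N ∣
             (ℚ.<⇒≤ (proj₂ (cauchy x 1ℚ 1>0) n N N≤n ℕ.≤-refl)) ⟩
      B ∎

abstract
  const-cauchy : ∀ q → Cauchy (λ _ → q)
  const-cauchy q = toCauchy (λ _ → q) (Two.null-0 (λ _ → ℚ.+-inverseʳ q))

  +-cauchy : ∀ x y → Cauchy (λ n → seq x n ℚ.+ seq y n)
  +-cauchy x y = toCauchy (λ n → seq x n ℚ.+ seq y n) (Two.null-cong
    (λ (m , n) → solve 4 (λ a b c d → (a :- b) :+ (c :- d) := (a :+ c) :- (b :+ d)) refl
      (seq x m) (seq x n) (seq y m) (seq y n))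
    (Two.null-+ (fromCauchy x) (fromCauchy y)))
    where open +-*-Solver

  neg-cauchy : ∀ x → Cauchy (λ n → ℚ.- seq x n)
  neg-cauchy x = toCauchy (λ n → ℚ.- seq x n) (Two.null-cong
    (λ (m , n) → solve 2 (λ a b → :- (a :- b) := (:- a) :- (:- b)) refl
      (seq x m) (seq x n))
    (Two.null-neg (fromCauchy x)))
    where open +-*-Solver

  *-cauchy : ∀ x y → Cauchy (λ n → seq x n ℚ.* seq y n)
  *-cauchy x y = toCauchy (λ n → seq x n ℚ.* seq y n) (Two.null-cong
    (λ (m , n) → solve 4
      (λ a b c d → (a :* (c :- d)) :+ (d :* (a :- b)) := (a :* c) :- (b :* d)) refl
      (seq x m) (seq x n) (seq y m) (seq y n))
    (Two.null-+
      (Two.null-* boundedˡ (fromCauchy y))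
      (Two.null-* boundedʳ (fromCauchy x))))
    where
    open +-*-Solver
    boundedˡ : Two.Bounded (λ i → seq x (proj₁ i))
    boundedˡ = let B , B>0 , N , b = bounded x in
      B , B>0 , N , λ i e → b _ (proj₁ e)
    boundedʳ : Two.Bounded (λ i → seq y (proj₂ i))
    boundedʳ = let B , B>0 , N , b = bounded y in
      B , B>0 , N , λ i e → b _ (proj₂ e)

fromℚ : ℚ → ℝ
fromℚ q = mkℝ (λ _ → q) (const-cauchy q)

infixl 6 _+ᴿ_
infixl 7 _*ᴿ_
infix  8 -ᴿ_

_+ᴿ_ _*ᴿ_ : ℝ → ℝ → ℝ
x +ᴿ y = mkℝ (λ n → seq x n ℚ.+ seq y n) (+-cauchy x y)
x *ᴿ y = mkℝ (λ n → seq x n ℚ.* seq y n) (*-cauchy x y)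

-ᴿ_ : ℝ → ℝ
-ᴿ x = mkℝ (λ n → ℚ.- seq x n) (neg-cauchy x)

≈ᴿ-pointwise : ∀ {x y} → (∀ n → seq x n ≡ seq y n) → x ≈ᴿ y
≈ᴿ-pointwise {x} {y} h = mk≈ (One.null-0 λ n →
  trans (cong (ℚ._- seq y n) (h n)) (ℚ.+-inverseʳ (seq y n)))

≈ᴿ-refl : ∀ {x} → x ≈ᴿ x
≈ᴿ-refl = ≈ᴿ-pointwise (λ _ → refl)

≈ᴿ-sym : ∀ {x y} → x ≈ᴿ y → y ≈ᴿ x
≈ᴿ-sym {x} {y} h = mk≈ (One.null-cong
  (λ n → solve 2 (λ a b → :- (a :- b) := b :- a) refl (seq x n) (seq y n))
  (One.null-neg (difference h)))
  where open +-*-Solver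

≈ᴿ-trans : ∀ {x y z} → x ≈ᴿ y → y ≈ᴿ z → x ≈ᴿ z
≈ᴿ-trans {x} {y} {z} h k = mk≈ (One.null-cong
  (λ n → solve 3 (λ a b c → (a :- b) :+ (b :- c) := a :- c) refl
    (seq x n) (seq y n) (seq z n))
  (One.null-+ (difference h) (difference k)))
  where open +-*-Solver

+ᴿ-cong : ∀ {x x′ y y′} → x ≈ᴿ x′ → y ≈ᴿ y′ → x +ᴿ y ≈ᴿ x′ +ᴿ y′
+ᴿ-cong {x} {x′} {y} {y′} h k = mk≈ (One.null-cong
  (λ n → solve 4 (λ a b c d → (a :- b) :+ (c :- d) := (a :+ c) :- (b :+ d)) refl
    (seq x n) (seq x′ n) (seq y n) (seq y′ n))
  (One.null-+ (difference h) (difference k)))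
  where open +-*-Solver

-ᴿ-cong : ∀ {x y} → x ≈ᴿ y → -ᴿ x ≈ᴿ -ᴿ y
-ᴿ-cong {x} {y} h = mk≈ (One.null-cong
  (λ n → solve 2 (λ a b → :- (a :- b) := (:- a) :- (:- b)) refl (seq x n) (seq y n))
  (One.null-neg (difference h)))
  where open +-*-Solver

*ᴿ-cong : ∀ {x x′ y y′} → x ≈ᴿ x′ → y ≈ᴿ y′ → x *ᴿ y ≈ᴿ x′ *ᴿ y′
*ᴿ-cong {x} {x′} {y} {y′} h k = mk≈ (One.null-cong
  (λ n → solve 4
    (λ a b c d → (a :* (c :- d)) :+ (d :* (a :- b)) := (a :* c) :- (b :* d)) refl
    (seq x n) (seq x′ n) (seq y n) (seq y′ n))
  (One.null-+ (One.null-* (bounded x) (difference k)) (One.null-* (bounded y′) (difference h))))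
  where open +-*-Solver

------------------------------------------------------------------------
-- Complex numbers

record ℂ : Set where
  constructor _+i_
  field
    re im : ℝ

open ℂ public

infix 4 _≈ᶜ_

record _≈ᶜ_ (z w : ℂ) : Set where
  constructor _+i≈_
  field
    re≈ : re z ≈ᴿ re w
    im≈ : im z ≈ᴿ im w

open _≈ᶜ_ public

0ᶜ 1ᶜ 𝐢 : ℂ
0ᶜ = fromℚ 0ℚ +i fromℚ 0ℚ
1ᶜ = fromℚ 1ℚ +i fromℚ 0ℚ
𝐢  = fromℚ 0ℚ +i fromℚ 1ℚ

infixl 6 _+ᶜ_
infixl 7 _*ᶜ_
infix  8 -ᶜ_

_+ᶜ_ _*ᶜ_ : ℂ → ℂ → ℂ
z +ᶜ w = (re z +ᴿ re w) +i (im z +ᴿ im w)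
z *ᶜ w = (re z *ᴿ re w +ᴿ -ᴿ (im z *ᴿ im w)) +i (re z *ᴿ im w +ᴿ im z *ᴿ re w)

-ᶜ_ : ℂ → ℂ
-ᶜ z = (-ᴿ re z) +i (-ᴿ im z)

private
  open +-*-Solver

  ≈ᶜ-pointwise : ∀ {z w} →
    (∀ n → seq (re z) n ≡ seq (re w) n) → (∀ n → seq (im z) n ≡ seq (im w) n) → z ≈ᶜ w
  ≈ᶜ-pointwise h k = ≈ᴿ-pointwise h +i≈ ≈ᴿ-pointwise k

  +ᶜ-assoc : ∀ x y z → (x +ᶜ y) +ᶜ z ≈ᶜ x +ᶜ (y +ᶜ z)
  +ᶜ-assoc x y z = ≈ᶜ-pointwise
    (λ n → solve 6 (λ a b c d e f → (a :+ c) :+ e := a :+ (c :+ e)) refl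
      (seq (re x) n) (seq (im x) n) (seq (re y) n) (seq (im y) n)
      (seq (re z) n) (seq (im z) n))
    (λ n → solve 6 (λ a b c d e f → (b :+ d) :+ f := b :+ (d :+ f)) refl
      (seq (re x) n) (seq (im x) n) (seq (re y) n) (seq (im y) n)
      (seq (re z) n) (seq (im z) n))

  +ᶜ-comm : ∀ x y → x +ᶜ y ≈ᶜ y +ᶜ x
  +ᶜ-comm x y = ≈ᶜ-pointwise
    (λ n → solve 4 (λ a b c d → a :+ c := c :+ a) refl
      (seq (re x) n) (seq (im x) n) (seq (re y) n) (seq (im y) n))
    (λ n → solve 4 (λ a b c d → b :+ d := d :+ b) refl
      (seq (re x) n) (seq (im x) n) (seq (re y) n) (seq (im y) n))

  +ᶜ-identityˡ : ∀ x → 0ᶜ +ᶜ x ≈ᶜ x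
  +ᶜ-identityˡ x = ≈ᶜ-pointwise
    (λ n → solve 2 (λ a b → con 0ℚ :+ a := a) refl
      (seq (re x) n) (seq (im x) n))
    (λ n → solve 2 (λ a b → con 0ℚ :+ b := b) refl
      (seq (re x) n) (seq (im x) n))

  +ᶜ-identityʳ : ∀ x → x +ᶜ 0ᶜ ≈ᶜ x
  +ᶜ-identityʳ x = ≈ᶜ-pointwise
    (λ n → solve 2 (λ a b → a :+ con 0ℚ := a) refl
      (seq (re x) n) (seq (im x) n))
    (λ n → solve 2 (λ a b → b :+ con 0ℚ := b) refl
      (seq (re x) n) (seq (im x) n))

  -ᶜ-inverseˡ : ∀ x → -ᶜ x +ᶜ x ≈ᶜ 0ᶜ
  -ᶜ-inverseˡ x = ≈ᶜ-pointwise
    (λ n → solve 2 (λ a b → :- a :+ a := con 0ℚ) refl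
      (seq (re x) n) (seq (im x) n))
    (λ n → solve 2 (λ a b → :- b :+ b := con 0ℚ) refl
      (seq (re x) n) (seq (im x) n))

  -ᶜ-inverseʳ : ∀ x → x +ᶜ -ᶜ x ≈ᶜ 0ᶜ
  -ᶜ-inverseʳ x = ≈ᶜ-pointwise
    (λ n → solve 2 (λ a b → a :+ :- a := con 0ℚ) refl
      (seq (re x) n) (seq (im x) n))
    (λ n → solve 2 (λ a b → b :+ :- b := con 0ℚ) refl
      (seq (re x) n) (seq (im x) n))

  *ᶜ-assoc : ∀ x y z → (x *ᶜ y) *ᶜ z ≈ᶜ x *ᶜ (y *ᶜ z)
  *ᶜ-assoc x y z = ≈ᶜ-pointwise
    (λ n → solve 6 (λ a b c d e f → (a :* c :- b :* d) :* e :- (a :* d :+ b :* c) :* f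
        := a :* (c :* e :- d :* f) :- b :* (c :* f :+ d :* e)) refl
      (seq (re x) n) (seq (im x) n) (seq (re y) n) (seq (im y) n)
      (seq (re z) n) (seq (im z) n))
    (λ n → solve 6 (λ a b c d e f → (a :* c :- b :* d) :* f :+ (a :* d :+ b :* c) :* e
        := a :* (c :* f :+ d :* e) :+ b :* (c :* e :- d :* f)) refl
      (seq (re x) n) (seq (im x) n) (seq (re y) n) (seq (im y) n)
      (seq (re z) n) (seq (im z) n))

  *ᶜ-comm : ∀ x y → x *ᶜ y ≈ᶜ y *ᶜ x
  *ᶜ-comm x y = ≈ᶜ-pointwise
    (λ n → solve 4 (λ a b c d → a :* c :- b :* d := c :* a :- d :* b) refl
      (seq (re x) n) (seq (im x) n) (seq (re y) n) (seq (im y) n))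
    (λ n → solve 4 (λ a b c d → a :* d :+ b :* c := c :* b :+ d :* a) refl
      (seq (re x) n) (seq (im x) n) (seq (re y) n) (seq (im y) n))

  *ᶜ-identityˡ : ∀ x → 1ᶜ *ᶜ x ≈ᶜ x
  *ᶜ-identityˡ x = ≈ᶜ-pointwise
    (λ n → solve 2 (λ a b → con 1ℚ :* a :- con 0ℚ :* b := a) refl
      (seq (re x) n) (seq (im x) n))
    (λ n → solve 2 (λ a b → con 1ℚ :* b :+ con 0ℚ :* a := b) refl
      (seq (re x) n) (seq (im x) n))

  *ᶜ-identityʳ : ∀ x → x *ᶜ 1ᶜ ≈ᶜ x
  *ᶜ-identityʳ x = ≈ᶜ-pointwise
    (λ n → solve 2 (λ a b → a :* con 1ℚ :- b :* con 0ℚ := a) refl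
      (seq (re x) n) (seq (im x) n))
    (λ n → solve 2 (λ a b → a :* con 0ℚ :+ b :* con 1ℚ := b) refl
      (seq (re x) n) (seq (im x) n))

  *ᶜ-distribˡ : ∀ x y z → x *ᶜ (y +ᶜ z) ≈ᶜ x *ᶜ y +ᶜ x *ᶜ z
  *ᶜ-distribˡ x y z = ≈ᶜ-pointwise
    (λ n → solve 6 (λ a b c d e f → a :* (c :+ e) :- b :* (d :+ f)
        := (a :* c :- b :* d) :+ (a :* e :- b :* f)) refl
      (seq (re x) n) (seq (im x) n) (seq (re y) n) (seq (im y) n)
      (seq (re z) n) (seq (im z) n))
    (λ n → solve 6 (λ a b c d e f → a :* (d :+ f) :+ b :* (c :+ e)
        := (a :* d :+ b :* c) :+ (a :* f :+ b :* e)) refl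
      (seq (re x) n) (seq (im x) n) (seq (re y) n) (seq (im y) n)
      (seq (re z) n) (seq (im z) n))

  *ᶜ-distribʳ : ∀ x y z → (y +ᶜ z) *ᶜ x ≈ᶜ y *ᶜ x +ᶜ z *ᶜ x
  *ᶜ-distribʳ x y z = ≈ᶜ-pointwise
    (λ n → solve 6 (λ a b c d e f → (c :+ e) :* a :- (d :+ f) :* b
        := (c :* a :- d :* b) :+ (e :* a :- f :* b)) refl
      (seq (re x) n) (seq (im x) n) (seq (re y) n) (seq (im y) n)
      (seq (re z) n) (seq (im z) n))
    (λ n → solve 6 (λ a b c d e f → (c :+ e) :* b :+ (d :+ f) :* a
        := (c :* b :+ d :* a) :+ (e :* b :+ f :* a)) refl
      (seq (re x) n) (seq (im x) n) (seq (re y) n) (seq (im y) n)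
      (seq (re z) n) (seq (im z) n))

  +ᶜ-cong : ∀ {x x′ y y′} → x ≈ᶜ x′ → y ≈ᶜ y′ → x +ᶜ y ≈ᶜ x′ +ᶜ y′
  +ᶜ-cong p q = +ᴿ-cong (re≈ p) (re≈ q) +i≈ +ᴿ-cong (im≈ p) (im≈ q)

  -ᶜ-cong : ∀ {x y} → x ≈ᶜ y → -ᶜ x ≈ᶜ -ᶜ y
  -ᶜ-cong p = -ᴿ-cong (re≈ p) +i≈ -ᴿ-cong (im≈ p)

  *ᶜ-cong : ∀ {x x′ y y′} → x ≈ᶜ x′ → y ≈ᶜ y′ → x *ᶜ y ≈ᶜ x′ *ᶜ y′
  *ᶜ-cong {x} {x′} {y} {y′} p q =
    +ᴿ-cong {re x *ᴿ re y} {re x′ *ᴿ re y′} { -ᴿ (im x *ᴿ im y)} { -ᴿ (im x′ *ᴿ im y′)}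
      (*ᴿ-cong (re≈ p) (re≈ q)) (-ᴿ-cong (*ᴿ-cong (im≈ p) (im≈ q)))
    +i≈
    +ᴿ-cong {re x *ᴿ im y} {re x′ *ᴿ im y′} {im x *ᴿ re y} {im x′ *ᴿ re y′}
      (*ᴿ-cong (re≈ p) (im≈ q)) (*ᴿ-cong (im≈ p) (re≈ q))

ℂ-commutativeRing : CommutativeRing 0ℓ 0ℓ
ℂ-commutativeRing = record
  { Carrier = ℂ
  ; _≈_     = _≈ᶜ_
  ; _+_     = _+ᶜ_
  ; _*_     = _*ᶜ_
  ; -_      = -ᶜ_
  ; 0#      = 0ᶜ
  ; 1#      = 1ᶜ
  ; isCommutativeRing = record
    { isRing = record
      { +-isAbelianGroup = record
        { isGroup = record
          { isMonoid = record
            { isSemigroup = record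
              { isMagma = record
                { isEquivalence = record
                  { refl  = ≈ᴿ-refl +i≈ ≈ᴿ-refl
                  ; sym   = λ p → ≈ᴿ-sym (re≈ p) +i≈ ≈ᴿ-sym (im≈ p)
                  ; trans = λ p q →
                      ≈ᴿ-trans (re≈ p) (re≈ q) +i≈ ≈ᴿ-trans (im≈ p) (im≈ q)
                  }
                ; ∙-cong = +ᶜ-cong
                }
              ; assoc = +ᶜ-assoc
              }
            ; identity = +ᶜ-identityˡ , +ᶜ-identityʳ
            }
          ; inverse = -ᶜ-inverseˡ , -ᶜ-inverseʳ
          ; ⁻¹-cong = -ᶜ-cong
          }
        ; comm = +ᶜ-comm
        }
      ; *-cong = *ᶜ-cong
      ; *-assoc = *ᶜ-assoc
      ; *-identity = *ᶜ-identityˡ , *ᶜ-identityʳ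
      ; distrib = *ᶜ-distribˡ , *ᶜ-distribʳ
      }
    ; *-comm = *ᶜ-comm
    }
  }

open CommutativeRing ℂ-commutativeRing public
  using (0#; 1#; _≈_; _+_; _*_; -_; +-commutativeMonoid; *-commutativeMonoid)

open import Algebra.Properties.CommutativeMonoid.Sum +-commutativeMonoid public
  using () renaming (sum to ∑)
open import Algebra.Properties.CommutativeMonoid.Sum *-commutativeMonoid public
  using () renaming (sum to ∏)

𝐢*𝐢≈-1 : 𝐢 * 𝐢 ≈ - 1#
𝐢*𝐢≈-1 = ≈ᶜ-pointwise (λ _ → refl) (λ _ → refl)

fromℤ : ℤ → ℂ
fromℤ k = fromℚ (k ℚ./ 1) +i fromℚ 0ℚ

------------------------------------------------------------------------
-- Path-length distance in a graph

module _ {V : Set} (_~_ : Rel V 0ℓ) where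

  data Walk : V → V → ℕ → Set where
    []  : ∀ {u} → Walk u u 0
    _∷_ : ∀ {u v w n} → u ~ v → Walk v w n → Walk u w (suc n)

  -- A walk of least length is a path.
  IsDistance : V → V → ℕ → Set
  IsDistance u v n = Walk u v n × (∀ m → Walk u v m → n ℕ.≤ m)

------------------------------------------------------------------------
-- The D-cube

X : ℕ → Set
X D = Vec (Fin 2) D

infix 4 _~_ _~?_ _≟ˣ_

_~_ : ∀ {D} → Rel (X D) 0ℓ
y ~ z = ∃! _≡_ λ k → lookup y k ≢ lookup z k

_~?_ : ∀ {D} → Decidable (_~_ {D})
y ~? z = Fin.any? λ k →
  ¬? (lookup y k Fin.≟ lookup z k) ×-dec
  map′ (λ h {j} → h j) (λ h j → h {j})
    (Fin.all? λ j → ¬? (lookup y j Fin.≟ lookup z j) →-dec (k Fin.≟ j))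

_≟ˣ_ : ∀ {D} → Decidable (_≡_ {A = X D})
_≟ˣ_ = ≡-dec Fin._≟_

~-here : ∀ {D a b} (y : X D) → a ≢ b → (a ∷ y) ~ (b ∷ y)
~-here {a = a} {b} y a≢b = zero , a≢b , λ {j} → uniq j
  where
  uniq : ∀ j → lookup (a ∷ y) j ≢ lookup (b ∷ y) j → zero ≡ j
  uniq zero    _ = refl
  uniq (suc j) h = contradiction refl h

~-there : ∀ {D} a {y z : X D} → y ~ z → (a ∷ y) ~ (a ∷ z)
~-there a {y} {z} (k , k≢ , uniq) = suc k , k≢ , λ {j} → uniq′ j
  where
  uniq′ : ∀ j → lookup (a ∷ y) j ≢ lookup (a ∷ z) j → suc k ≡ j
  uniq′ zero    h = contradiction refl h
  uniq′ (suc j) h = cong suc (uniq h)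

lookup-≡ : ∀ {D} {y z : X D} → (∀ k → ¬ (lookup y k ≢ lookup z k)) → y ≡ z
lookup-≡ {y = []}    {[]}    h = refl
lookup-≡ {y = a ∷ y} {b ∷ z} h with a Fin.≟ b
... | yes a≡b = cong₂ _∷_ a≡b (lookup-≡ (h ∘ suc))
... | no  a≢b = contradiction a≢b (h zero)

hamming : ∀ {D} → X D → X D → ℕ
hamming []      []      = 0
hamming (a ∷ y) (b ∷ z) with a Fin.≟ b
... | yes _ = hamming y z
... | no  _ = suc (hamming y z)

hamming-refl : ∀ {D} (y : X D) → hamming y y ≡ 0
hamming-refl []      = refl
hamming-refl (a ∷ y) with a Fin.≟ a
... | yes _   = hamming-refl y
... | no  a≢a = contradiction refl a≢a

hamming-step : ∀ {D} (y v z : X D) → y ~ v → hamming y z ℕ.≤ suc (hamming v z)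
hamming-step (a ∷ y) (b ∷ v) (c ∷ z) (zero , _ , uniq)
  with refl ← lookup-≡ {y = y} {v} (λ k h → Fin.0≢1+n (uniq {suc k} h))
  with a Fin.≟ c | b Fin.≟ c
... | yes _ | yes _ = ℕ.n≤1+n _
... | yes _ | no  _ = ℕ.≤-trans (ℕ.n≤1+n _) (ℕ.n≤1+n _)
... | no  _ | yes _ = ℕ.≤-refl
... | no  _ | no  _ = ℕ.n≤1+n _
hamming-step (a ∷ y) (b ∷ v) (c ∷ z) (suc k , k≢ , uniq) with a Fin.≟ b
... | no a≢b = contradiction (sym (uniq {zero} a≢b)) Fin.0≢1+n
... | yes refl with a Fin.≟ c
...   | yes _ = hamming-step y v z (k , k≢ , λ h → Fin.suc-injective (uniq h))
...   | no  _ = ℕ.s≤s (hamming-step y v z (k , k≢ , λ h → Fin.suc-injective (uniq h)))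

walk-there : ∀ {D} a {y z : X D} {n} → Walk _~_ y z n → Walk _~_ (a ∷ y) (a ∷ z) n
walk-there a []      = []
walk-there a (e ∷ w) = ~-there a e ∷ walk-there a w

hamming-walk : ∀ {D} (y z : X D) → Walk _~_ y z (hamming y z)
hamming-walk []      []      = []
hamming-walk (a ∷ y) (b ∷ z) with a Fin.≟ b
... | yes refl = walk-there a (hamming-walk y z)
... | no  a≢b  = ~-here y a≢b ∷ walk-there b (hamming-walk y z)

hamming-least : ∀ {D} (y z : X D) m → Walk _~_ y z m → hamming y z ℕ.≤ m
hamming-least y .y .0       []      = ℕ.≤-reflexive (hamming-refl y)
hamming-least y z  .(suc _) (_∷_ {v = v} e w) =
  ℕ.≤-trans (hamming-step y v z e) (ℕ.s≤s (hamming-least v z _ w))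

-- The distance is hamming by computation; the other two components show
-- that it is the path-length distance of the graph (X D , _~_).
distance : ∀ {D} (y z : X D) → ∃ (IsDistance _~_ y z)
distance y z = hamming y z , hamming-walk y z , hamming-least y z

∂ : ∀ {D} → X D → X D → ℕ
∂ y z = proj₁ (distance y z)

------------------------------------------------------------------------
-- Mat_X(ℂ)

∑ˣ : ∀ D → (X D → ℂ) → ℂ
∑ˣ zero    f = f []
∑ˣ (suc D) f = ∑ {2} λ b → ∑ˣ D λ y → f (b ∷ y)

Mat : ℕ → Set
Mat D = X D → X D → ℂ

infix  4 _≈ᴹ_
infixl 6 _+ᴹ_
infixl 7 _*ᴹ_
infixr 8 _•_

_≈ᴹ_ : ∀ {D} → Rel (Mat D) 0ℓ
M ≈ᴹ N = ∀ y z → M y z ≈ N y z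

1ᴹ : ∀ {D} → Mat D
1ᴹ y z = if does (y ≟ˣ z) then 1# else 0#

_+ᴹ_ _*ᴹ_ : ∀ {D} → Mat D → Mat D → Mat D
(M +ᴹ N) y z = M y z + N y z
_*ᴹ_ {D} M N y z = ∑ˣ D λ w → M y w * N w z

_•_ : ∀ {D} → ℂ → Mat D → Mat D
(c • M) y z = c * M y z

-- The (unital) subalgebra generated by a set of matrices.  Closure under
-- ≈ᴹ is needed because ≈ᴹ is the equality of matrices.
data Subalgebra⟨_⟩ {D} (S : Pred (Mat D) 0ℓ) : Pred (Mat D) 0ℓ where
  gen  : ∀ {M} → S M → Subalgebra⟨ S ⟩ M
  one  : Subalgebra⟨ S ⟩ 1ᴹ
  add  : ∀ {M N} → Subalgebra⟨ S ⟩ M → Subalgebra⟨ S ⟩ N → Subalgebra⟨ S ⟩ (M +ᴹ N)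
  mul  : ∀ {M N} → Subalgebra⟨ S ⟩ M → Subalgebra⟨ S ⟩ N → Subalgebra⟨ S ⟩ (M *ᴹ N)
  scal : ∀ c {M} → Subalgebra⟨ S ⟩ M → Subalgebra⟨ S ⟩ (c • M)
  resp : ∀ {M N} → M ≈ᴹ N → Subalgebra⟨ S ⟩ M → Subalgebra⟨ S ⟩ N

------------------------------------------------------------------------
-- The Terwilliger algebra of the D-cube

x₀ : ∀ {D} → X D
x₀ {D} = replicate D zero

A : ∀ D → Mat D
A D y z = if does (y ~? z) then 1# else 0#

A* : ∀ D → Mat D
A* D y z = if does (y ≟ˣ z) then fromℤ (+ D ℤ.- + (2 ℕ.* ∂ x₀ y)) else 0#

T : ∀ D → Pred (Mat D) 0ℓ
T D = Subalgebra⟨ ｛ A D ｝ ∪ ｛ A* D ｝ ⟩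

P₁ : Fin 2 → Fin 2 → ℂ
P₁ zero       zero       = 1#
P₁ zero       (suc zero) = 1#
P₁ (suc zero) zero       = - 𝐢
P₁ (suc zero) (suc zero) = 𝐢

P : ∀ D → Mat D
P D y z = ∏ λ k → P₁ (lookup y k) (lookup z k)

{-# OPTIONS --safe #-}
-- P₁ = (1 - i) F(X) F(Z) for the Pauli matrices X and Z, where F(M) = I + (i - 1) E with
-- E = (I - M)/2 an idempotent.  Taking Kronecker powers, it suffices that F(X)^⊗D and F(Z)^⊗D
-- lie in T.  Now (I + s E)^⊗D = Σₖ sᵏ eₖ, with eₖ the k-th elementary symmetric function of the
-- D commuting idempotents Eⱼ that act as E on the j-th tensor factor.  Their sum W satisfies
-- W eₖ = k eₖ + (k + 1) eₖ₊₁, so every eₖ is a polynomial in W.  Finally W = (D - Σⱼ Mⱼ)/2, where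
-- Σⱼ Mⱼ is A for M = X and A* for M = Z.
module Submission where

open import Data.Nat.Base using (ℕ; NonZero)
open import Relation.Unary using (_∈_)

open import Algebra.Bundles using (CommutativeRing; CommutativeSemiring)
open import Data.Bool.Base using (true; false; if_then_else_)
open import Data.Fin.Base using (Fin; zero; suc)
import Data.Fin.Properties as Fin
open import Data.Integer.Base as ℤ using (+_; -[1+_])
import Data.Integer.Properties as ℤ
open import Data.Integer.Tactic.RingSolver using (solve-∀)
open import Data.Nat.Base as ℕ using (zero; suc; z≤n; s≤s)
import Data.Nat.Properties as ℕ
open import Data.Product.Base using (_,_)
open import Data.Rational.Base as ℚ using (0ℚ; 1ℚ; ½)
import Data.Rational.Properties as ℚ
open import Data.Rational.Unnormalised.Base as ℚᵘ using (mkℚᵘ; *≡*)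
import Data.Rational.Unnormalised.Properties as ℚᵘ
open import Data.Sum.Base using (inj₁; inj₂)
open import Data.Vec.Base using ([]; _∷_)
open import Function.Bundles using (mk⇔)
open import Level using (0ℓ)
open import Relation.Binary.Bundles using (Setoid)
open import Relation.Binary.PropositionalEquality as ≡ using (_≡_; _≢_)
import Relation.Binary.Reasoning.Setoid as SetoidReasoning
open import Relation.Nullary.Decidable using (does; does-⇔)
open import Relation.Nullary.Negation.Core using (contradiction)
open import Relation.Unary using (Pred)

-- The solver runs over an abstract semiring, where the operations of ℂ cannot unfold.
module Identities {c ℓ} (R : CommutativeSemiring c ℓ) where
  open CommutativeSemiring R
  open import Algebra.Solver.Ring.NaturalCoefficients.Default R

  *-interchange : ∀ a b c d → (a * b) * (c * d) ≈ (a * c) * (b * d)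
  *-interchange = solve 4 (λ a b c d → (a :* b) :* (c :* d) := (a :* c) :* (b :* d)) refl

  ∑₂-+ : ∀ a b c d → (a + b) + ((c + d) + 0#) ≈ (a + (c + 0#)) + (b + (d + 0#))
  ∑₂-+ = solve 4 (λ a b c d →
    (a :+ b) :+ ((c :+ d) :+ con 0) := (a :+ (c :+ con 0)) :+ (b :+ (d :+ con 0))) refl

  ∑₂-*ˡ : ∀ a b c → a * b + (a * c + 0#) ≈ a * (b + (c + 0#))
  ∑₂-*ˡ = solve 3 (λ a b c → a :* b :+ (a :* c :+ con 0) := a :* (b :+ (c :+ con 0))) refl

  ∑₂-*ʳ : ∀ a b c → a * c + (b * c + 0#) ≈ (a + (b + 0#)) * c
  ∑₂-*ʳ = solve 3 (λ a b c → a :* c :+ (b :* c :+ con 0) := (a :+ (b :+ con 0)) :* c) refl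

  1*x+0*y≈x : ∀ x y → 1# * x + (0# * y + 0#) ≈ x
  1*x+0*y≈x = solve 2 (λ x y → con 1 :* x :+ (con 0 :* y :+ con 0) := x) refl

  0*x+1*y≈y : ∀ x y → 0# * x + (1# * y + 0#) ≈ y
  0*x+1*y≈y = solve 2 (λ x y → con 0 :* x :+ (con 1 :* y :+ con 0) := y) refl

  x*1+y*0≈x : ∀ x y → x * 1# + (y * 0# + 0#) ≈ x
  x*1+y*0≈x = solve 2 (λ x y → x :* con 1 :+ (y :* con 0 :+ con 0) := x) refl

  x*0+y*1≈y : ∀ x y → x * 0# + (y * 1# + 0#) ≈ y
  x*0+y*1≈y = solve 2 (λ x y → x :* con 0 :+ (y :* con 1 :+ con 0) := y) refl

  recurrence-suc : ∀ d e k u v w →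
    d * (k * u + (1# + k) * w) + (e * (k * v + k * u) + e * u) ≈
    k * (d * u + e * v) + (1# + k) * (d * w + e * u)
  recurrence-suc = solve 6 (λ d e k u v w →
    d :* (k :* u :+ (con 1 :+ k) :* w) :+ (e :* (k :* v :+ k :* u) :+ e :* u) :=
    k :* (d :* u :+ e :* v) :+ (con 1 :+ k) :* (d :* w :+ e :* u)) refl

  recurrence-shift : ∀ j k u w → (j * u + k * w) + u ≈ (1# + j) * u + k * w
  recurrence-shift = solve 4 (λ j k u w →
    (j :* u :+ k :* w) :+ u := (con 1 :+ j) :* u :+ k :* w) refl

  regroup : ∀ a e x u v → a + (e * x + (e * u + e * v)) ≈ a + (e * (x + v) + e * u)
  regroup = solve 5 (λ a e x u v →
    a :+ (e :* x :+ (e :* u :+ e :* v)) := a :+ (e :* (x :+ v) :+ e :* u)) refl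

  partialSum-1 : ∀ d e s u v →
    (d * u + e * 0#) + (s * 1#) * (d * v + e * u) ≈ d * (u + (s * 1#) * v) + (s * e) * u
  partialSum-1 = solve 5 (λ d e s u v →
    (d :* u :+ e :* con 0) :+ (s :* con 1) :* (d :* v :+ e :* u) :=
    d :* (u :+ (s :* con 1) :* v) :+ (s :* e) :* u) refl

  partialSum-suc : ∀ d e s t p q u v →
    (d * p + (s * e) * q) + (s * t) * (d * v + e * u) ≈
    d * (p + (s * t) * v) + (s * e) * (q + t * u)
  partialSum-suc = solve 8 (λ d e s t p q u v →
    (d :* p :+ (s :* e) :* q) :+ (s :* t) :* (d :* v :+ e :* u) :=
    d :* (p :+ (s :* t) :* v) :+ (s :* e) :* (q :+ t :* u)) refl

  -- Here `h` will be one half and `m` will be `- 1#`: a semiring identity cannot negate, so minus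
  -- one enters as a variable.
  complement-suc : ∀ h m n d o l x →
    d * (h * (n * o + m * l)) + (h * (d + m * x)) * o ≈
    h * ((1# + n) * (d * o) + m * (d * l + x * o))
  complement-suc = solve 7 (λ h m n d o l x →
    d :* (h :* (n :* o :+ m :* l)) :+ (h :* (d :+ m :* x)) :* o :=
    h :* ((con 1 :+ n) :* (d :* o) :+ m :* (d :* l :+ x :* o))) refl

  -- Again `m` stands for `- 1#`. The cancellation of `k + m * k` is left to the place of use, where
  -- `r * k′` also becomes `1#`.
  isolate : ∀ r m k k′ u w →
    r * ((k * u + k′ * w) + (m * k) * u) ≈ (r * k′) * w + r * ((k + m * k) * u)
  isolate = solve 6 (λ r m k k′ u w →
    r :* ((k :* u :+ k′ :* w) :+ (m :* k) :* u) :=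
    (r :* k′) :* w :+ r :* ((k :+ m :* k) :* u)) refl

open import Defs
open CommutativeRing ℂ-commutativeRing
  using (refl; sym; trans; setoid; semiring; ring; commutativeSemiring; -‿inverseʳ;
         +-cong; +-congˡ; +-congʳ; *-cong; *-congˡ; *-congʳ;
         reflexive; +-assoc; distribʳ; *-identityʳ;
         *-assoc; *-identityˡ; +-identityˡ; +-identityʳ; zeroˡ; zeroʳ; distribˡ)
open import Algebra.Properties.Semiring.Exp semiring using (_^_)
open import Algebra.Properties.Ring ring using (-1*x≈-x)

open Identities commutativeSemiring

-- Matrices indexed by the cube

≈ᴹ-setoid : ℕ → Setoid 0ℓ 0ℓ
≈ᴹ-setoid D = record
  { Carrier = Mat D
  ; _≈_ = _≈ᴹ_
  ; isEquivalence = record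
    { refl  = λ y z → refl
    ; sym   = λ p y z → sym (p y z)
    ; trans = λ p q y z → trans (p y z) (q y z)
    }
  }

module ≈ᴹ {D} = Setoid (≈ᴹ-setoid D)

0ᴹ : ∀ {D} → Mat D
0ᴹ y z = 0#

∑ˣ-cong : ∀ D {f g : X D → ℂ} → (∀ w → f w ≈ g w) → ∑ˣ D f ≈ ∑ˣ D g
∑ˣ-cong zero    h = h []
∑ˣ-cong (suc D) h = +-cong (∑ˣ-cong D λ w → h (zero ∷ w))
  (+-congʳ (∑ˣ-cong D λ w → h (suc zero ∷ w)))

∑ˣ-+ : ∀ D (f g : X D → ℂ) → ∑ˣ D (λ w → f w + g w) ≈ ∑ˣ D f + ∑ˣ D g
∑ˣ-+ zero    f g = refl
∑ˣ-+ (suc D) f g = trans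
  (+-cong (∑ˣ-+ D (λ w → f (zero ∷ w)) (λ w → g (zero ∷ w)))
    (+-congʳ (∑ˣ-+ D (λ w → f (suc zero ∷ w)) (λ w → g (suc zero ∷ w)))))
  (∑₂-+ _ _ _ _)

∑ˣ-*ˡ : ∀ D c (f : X D → ℂ) → ∑ˣ D (λ w → c * f w) ≈ c * ∑ˣ D f
∑ˣ-*ˡ zero    c f = refl
∑ˣ-*ˡ (suc D) c f = trans
  (+-cong (∑ˣ-*ˡ D c (λ w → f (zero ∷ w))) (+-congʳ (∑ˣ-*ˡ D c (λ w → f (suc zero ∷ w)))))
  (∑₂-*ˡ _ _ _)

*ᴹ-distribˡ : ∀ {D} (M N Q : Mat D) → M *ᴹ (N +ᴹ Q) ≈ᴹ M *ᴹ N +ᴹ M *ᴹ Q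
*ᴹ-distribˡ {D} M N Q y z = trans
  (∑ˣ-cong D λ w → distribˡ (M y w) (N w z) (Q w z))
  (∑ˣ-+ D (λ w → M y w * N w z) (λ w → M y w * Q w z))

*ᴹ-distribʳ : ∀ {D} (Q M N : Mat D) → (M +ᴹ N) *ᴹ Q ≈ᴹ M *ᴹ Q +ᴹ N *ᴹ Q
*ᴹ-distribʳ {D} Q M N y z = trans
  (∑ˣ-cong D λ w → distribʳ (Q w z) (M y w) (N y w))
  (∑ˣ-+ D (λ w → M y w * Q w z) (λ w → N y w * Q w z))

*ᴹ-zeroˡ : ∀ {D} (M : Mat D) → 0ᴹ *ᴹ M ≈ᴹ 0ᴹ
*ᴹ-zeroˡ {D} M y z = trans (∑ˣ-*ˡ D 0# (λ w → M w z)) (zeroˡ _)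

*ᴹ-zeroʳ : ∀ {D} (M : Mat D) → M *ᴹ 0ᴹ ≈ᴹ 0ᴹ
*ᴹ-zeroʳ {D} M y z = trans
  (∑ˣ-cong D λ w → trans (zeroʳ (M y w)) (sym (zeroˡ 0#)))
  (trans (∑ˣ-*ˡ D 0# (λ _ → 0#)) (zeroˡ _))

-- Kronecker products

Mat₂ : Set
Mat₂ = Fin 2 → Fin 2 → ℂ

infix 4 _≈₂_
infixr 8 _⋆_
infixl 7 _·_ _⊗_
infixl 6 _⊞_

_≈₂_ : Mat₂ → Mat₂ → Set
M ≈₂ N = ∀ a b → M a b ≈ N a b

I₂ : Mat₂
I₂ a b = if does (a Fin.≟ b) then 1# else 0#

_⊞_ _·_ : Mat₂ → Mat₂ → Mat₂
(M ⊞ N) a b = M a b + N a b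
(M · N) a c = ∑ {2} λ b → M a b * N b c

_⋆_ : ℂ → Mat₂ → Mat₂
(c ⋆ M) a b = c * M a b

_⊗_ : ∀ {D} → Mat₂ → Mat D → Mat (suc D)
(M ⊗ N) (a ∷ y) (b ∷ z) = M a b * N y z

·-identityˡ : ∀ M → I₂ · M ≈₂ M
·-identityˡ M zero       c = 1*x+0*y≈x _ _
·-identityˡ M (suc zero) c = 0*x+1*y≈y _ _

·-identityʳ : ∀ M → M · I₂ ≈₂ M
·-identityʳ M a zero       = x*1+y*0≈x _ _
·-identityʳ M a (suc zero) = x*0+y*1≈y _ _

⊗-cong : ∀ {D M M′} {N N′ : Mat D} → M ≈₂ M′ → N ≈ᴹ N′ → M ⊗ N ≈ᴹ M′ ⊗ N′
⊗-cong p q (a ∷ y) (b ∷ z) = *-cong (p a b) (q y z)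

-- The mixed-product rule. `∑ˣ (suc D)` is a sum over the head of sums over the tail, and the `Mat₂`
-- entries pull out of each inner sum.
⊗-* : ∀ {D} M M′ (N N′ : Mat D) → (M ⊗ N) *ᴹ (M′ ⊗ N′) ≈ᴹ (M · M′) ⊗ (N *ᴹ N′)
⊗-* {D} M M′ N N′ (a ∷ y) (c ∷ z) =
  trans (+-cong (block zero) (+-congʳ (block (suc zero)))) (∑₂-*ʳ _ _ _)
  where
  block : ∀ b → ∑ˣ D (λ w → (M a b * N y w) * (M′ b c * N′ w z)) ≈
                (M a b * M′ b c) * (N *ᴹ N′) y z
  block b = trans
    (∑ˣ-cong D λ w → *-interchange (M a b) (N y w) (M′ b c) (N′ w z))
    (∑ˣ-*ˡ D (M a b * M′ b c) (λ w → N y w * N′ w z))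

-- `1ᴹ` is given by a decision on whole vectors; this is its recursive form, needed in each
-- induction on `D` that meets the identity.
1⊗1 : ∀ {D} → I₂ ⊗ 1ᴹ {D} ≈ᴹ 1ᴹ
1⊗1 (a ∷ y) (b ∷ z) with does (a Fin.≟ b)
... | true  = *-identityˡ _
... | false = zeroˡ _

∑ˣ-δ : ∀ D y (f : X D → ℂ) → ∑ˣ D (λ w → 1ᴹ y w * f w) ≈ f y
∑ˣ-δ zero    []      f = *-identityˡ _
∑ˣ-δ (suc D) (a ∷ y) f =
  trans (+-cong (block zero) (+-congʳ (block (suc zero)))) (select a)
  where
  block : ∀ b → ∑ˣ D (λ w → 1ᴹ (a ∷ y) (b ∷ w) * f (b ∷ w)) ≈ I₂ a b * f (b ∷ y)
  block b = trans
    (∑ˣ-cong D λ w → trans (*-congʳ (sym (1⊗1 (a ∷ y) (b ∷ w)))) (*-assoc _ _ _))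
    (trans (∑ˣ-*ˡ D (I₂ a b) (λ w → 1ᴹ y w * f (b ∷ w)))
      (*-congˡ (∑ˣ-δ D y (λ w → f (b ∷ w)))))
  select : ∀ a → I₂ a zero * f (zero ∷ y) + (I₂ a (suc zero) * f (suc zero ∷ y) + 0#) ≈ f (a ∷ y)
  select zero       = 1*x+0*y≈x _ _
  select (suc zero) = 0*x+1*y≈y _ _

*ᴹ-identityˡ : ∀ {D} (M : Mat D) → 1ᴹ *ᴹ M ≈ᴹ M
*ᴹ-identityˡ {D} M y z = ∑ˣ-δ D y (λ w → M w z)

infix 9 _^⊗_

_^⊗_ : Mat₂ → ∀ D → Mat D
M ^⊗ zero  = 1ᴹ
M ^⊗ suc D = M ⊗ M ^⊗ D

^⊗-cong : ∀ {M N} → M ≈₂ N → ∀ D → M ^⊗ D ≈ᴹ N ^⊗ D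
^⊗-cong p zero    = ≈ᴹ.refl
^⊗-cong p (suc D) = ⊗-cong p (^⊗-cong p D)

^⊗-· : ∀ M N D → (M · N) ^⊗ D ≈ᴹ M ^⊗ D *ᴹ N ^⊗ D
^⊗-· M N zero    = ≈ᴹ.sym (*ᴹ-identityˡ 1ᴹ)
^⊗-· M N (suc D) = ≈ᴹ.trans
  (⊗-cong (λ _ _ → refl) (^⊗-· M N D))
  (≈ᴹ.sym (⊗-* M N (M ^⊗ D) (N ^⊗ D)))

^⊗-⋆ : ∀ c M D → (c ⋆ M) ^⊗ D ≈ᴹ (c ^ D) • (M ^⊗ D)
^⊗-⋆ c M zero    y       z       = sym (*-identityˡ _)
^⊗-⋆ c M (suc D) (a ∷ y) (b ∷ z) =
  trans (*-congˡ (^⊗-⋆ c M D y z)) (*-interchange _ _ _ _)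

P≈P₁^⊗ : ∀ D → P D ≈ᴹ P₁ ^⊗ D
P≈P₁^⊗ zero    []      []      = refl
P≈P₁^⊗ (suc D) (a ∷ y) (b ∷ z) = *-congˡ (P≈P₁^⊗ D y z)

-- The sum of the `D` copies of `M`, one in each tensor factor; the recursion splits off the copy in
-- the first factor.
kroneckerSum : Mat₂ → ∀ D → Mat D
kroneckerSum M zero    = 0ᴹ
kroneckerSum M (suc D) = I₂ ⊗ kroneckerSum M D +ᴹ M ⊗ 1ᴹ

-- Integers and their inverses in ℂ

≈-pointwise : ∀ {z w} →
  (∀ n → seq (re z) n ≡ seq (re w) n) → (∀ n → seq (im z) n ≡ seq (im w) n) → z ≈ w
≈-pointwise p q = ≈ᴿ-pointwise p +i≈ ≈ᴿ-pointwise q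

-- `ℚ./` normalises its result, so the real part does not compute for variable `i` and `j`. It is
-- compared among unnormalised fractions with denominator 1.
fromℤ-+ : ∀ i j → fromℤ (i ℤ.+ j) ≈ fromℤ i + fromℤ j
fromℤ-+ i j = ≈-pointwise (λ _ → /1-+) (λ _ → ≡.refl)
  where
  open ℚᵘ.≃-Reasoning
  /1-+ : (i ℤ.+ j) ℚ./ 1 ≡ (i ℚ./ 1) ℚ.+ (j ℚ./ 1)
  /1-+ = ℚ.toℚᵘ-injective (begin
    ℚ.toℚᵘ ((i ℤ.+ j) ℚ./ 1)
      ≈⟨ ℚ.toℚᵘ-fromℚᵘ (mkℚᵘ (i ℤ.+ j) 0) ⟩
    mkℚᵘ (i ℤ.+ j) 0
      ≈⟨ *≡* (≡.cong (ℤ._* + 1)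
           (≡.cong₂ ℤ._+_ (≡.sym (ℤ.*-identityʳ i)) (≡.sym (ℤ.*-identityʳ j)))) ⟩
    mkℚᵘ i 0 ℚᵘ.+ mkℚᵘ j 0
      ≈⟨ ℚᵘ.+-cong (ℚ.toℚᵘ-fromℚᵘ (mkℚᵘ i 0)) (ℚ.toℚᵘ-fromℚᵘ (mkℚᵘ j 0)) ⟨
    ℚ.toℚᵘ (i ℚ./ 1) ℚᵘ.+ ℚ.toℚᵘ (j ℚ./ 1)
      ≈⟨ ℚ.toℚᵘ-homo-+ (i ℚ./ 1) (j ℚ./ 1) ⟨
    ℚ.toℚᵘ ((i ℚ./ 1) ℚ.+ (j ℚ./ 1)) ∎)

fromℕ : ℕ → ℂ
fromℕ n = fromℤ (+ n)

fromℕ-0 : fromℕ 0 ≈ 0#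
fromℕ-0 = ≈-pointwise (λ _ → ≡.refl) (λ _ → ≡.refl)

fromℤ-1 : fromℤ (+ 1) ≈ 1#
fromℤ-1 = ≈-pointwise (λ _ → ≡.refl) (λ _ → ≡.refl)

fromℤ--1 : fromℤ -[1+ 0 ] ≈ - 1#
fromℤ--1 = ≈-pointwise (λ _ → ≡.refl) (λ _ → ≡.refl)

fromℕ-suc : ∀ n → fromℕ (suc n) ≈ 1# + fromℕ n
fromℕ-suc n = trans (fromℤ-+ (+ 1) (+ n)) (+-congʳ fromℤ-1)

1/suc : ℕ → ℂ
1/suc k = fromℚ (+ 1 ℚ./ suc k) +i fromℚ 0ℚ

1/suc-inverse : ∀ k → 1/suc k * fromℕ (suc k) ≈ 1#
1/suc-inverse k = ≈-pointwise
  (λ _ → ≡.cong (ℚ._+ 0ℚ) q*n≡1)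
  (λ _ → ≡.cong₂ ℚ._+_ (ℚ.*-zeroʳ q) (ℚ.*-zeroˡ n))
  where
  open ℚᵘ.≃-Reasoning
  q = + 1 ℚ./ suc k
  n = + suc k ℚ./ 1
  q*n≡1 : q ℚ.* n ≡ 1ℚ
  q*n≡1 = ℚ.toℚᵘ-injective (begin
    ℚ.toℚᵘ (q ℚ.* n)
      ≈⟨ ℚ.toℚᵘ-homo-* q n ⟩
    ℚ.toℚᵘ q ℚᵘ.* ℚ.toℚᵘ n
      ≈⟨ ℚᵘ.*-cong (ℚ.toℚᵘ-fromℚᵘ (mkℚᵘ (+ 1) k)) (ℚ.toℚᵘ-fromℚᵘ (mkℚᵘ (+ suc k) 0)) ⟩
    mkℚᵘ (+ 1) k ℚᵘ.* mkℚᵘ (+ suc k) 0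
      ≈⟨ *≡* (ℤ.*-assoc (+ 1) (+ suc k) (+ 1)) ⟩
    ℚᵘ.1ℚᵘ ∎)

-- Elementary symmetric functions of the copies of E in the tensor factors

shift : ∀ {D} → (ℕ → Mat D) → ℕ → Mat D
shift f zero    = 0ᴹ
shift f (suc k) = f k

-- A product of `k` distinct copies either omits the first tensor factor or uses it together with
-- `k - 1` of the others. `shift` supplies index `k - 1`, with zero at index -1.
e : Mat₂ → ∀ D → ℕ → Mat D
e E zero    zero    = 1ᴹ
e E zero    (suc k) = 0ᴹ
e E (suc D) k       = I₂ ⊗ e E D k +ᴹ E ⊗ shift (e E D) k

e-0 : ∀ E D → e E D 0 ≈ᴹ 1ᴹ
e-0 E zero    = ≈ᴹ.refl
e-0 E (suc D) (a ∷ y) (b ∷ z) = trans (+-congˡ (zeroʳ _)) (trans (+-identityʳ _)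
  (trans (*-congˡ (e-0 E D y z)) (1⊗1 (a ∷ y) (b ∷ z))))

e-partialSum : Mat₂ → ℂ → ∀ D → ℕ → Mat D
e-partialSum E s D zero    = e E D 0
e-partialSum E s D (suc N) = e-partialSum E s D N +ᴹ (s ^ suc N) • e E D (suc N)

-- In the terms that use the first factor, one power of `s` goes with `E` and the index drops by
-- one. Hence the cutoff `N` in the second summand.
e-partialSum-suc : ∀ E s D N →
  e-partialSum E s (suc D) (suc N) ≈ᴹ
  I₂ ⊗ e-partialSum E s D (suc N) +ᴹ (s ⋆ E) ⊗ e-partialSum E s D N
e-partialSum-suc E s D zero    (a ∷ y) (b ∷ z) = partialSum-1 _ _ _ _ _
e-partialSum-suc E s D (suc N) (a ∷ y) (b ∷ z) = trans
  (+-congʳ (e-partialSum-suc E s D N (a ∷ y) (b ∷ z)))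
  (partialSum-suc _ _ _ _ _ _ _ _)

-- Terms of index above `D` vanish, so any cutoff from `D` on gives the full generating function.
-- This slack is what the induction needs: its step uses the cutoffs `suc N` and `N` for the same
-- `D`.
e-generating : ∀ E s {D N} → D ℕ.≤ N → e-partialSum E s D N ≈ᴹ (I₂ ⊞ s ⋆ E) ^⊗ D
e-generating E s {N = zero}  z≤n = ≈ᴹ.refl
e-generating E s {N = suc N} z≤n y z =
  trans (+-cong (e-generating E s (z≤n {N}) y z) (zeroʳ _)) (+-identityʳ _)
e-generating E s {suc D} {suc N} (s≤s D≤N) (a ∷ y) (b ∷ z) = begin
  e-partialSum E s (suc D) (suc N) (a ∷ y) (b ∷ z)
    ≈⟨ e-partialSum-suc E s D N (a ∷ y) (b ∷ z) ⟩
  I₂ a b * e-partialSum E s D (suc N) y z + (s * E a b) * e-partialSum E s D N y z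
    ≈⟨ +-cong (*-congˡ (e-generating E s (ℕ.m≤n⇒m≤1+n D≤N) y z))
              (*-congˡ (e-generating E s D≤N y z)) ⟩
  I₂ a b * ((I₂ ⊞ s ⋆ E) ^⊗ D) y z + (s * E a b) * ((I₂ ⊞ s ⋆ E) ^⊗ D) y z
    ≈⟨ distribʳ _ (I₂ a b) (s * E a b) ⟨
  (I₂ a b + s * E a b) * ((I₂ ⊞ s ⋆ E) ^⊗ D) y z ∎
  where open SetoidReasoning setoid

-- The recurrence for copies of an idempotent

module Idempotent (E : Mat₂) (E·E≈E : E · E ≈₂ E) where

  -- The mixed-product rule on four cross terms. Idempotence enters only in the last, turning
  -- `E · E` into `E`.
  kroneckerSum-*-block : ∀ {D} (W u v : Mat D) →
    (I₂ ⊗ W +ᴹ E ⊗ 1ᴹ) *ᴹ (I₂ ⊗ u +ᴹ E ⊗ v) ≈ᴹ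
    I₂ ⊗ (W *ᴹ u) +ᴹ (E ⊗ (W *ᴹ v) +ᴹ (E ⊗ u +ᴹ E ⊗ v))
  kroneckerSum-*-block W u v y z = begin
    ((I₂ ⊗ W +ᴹ E ⊗ 1ᴹ) *ᴹ (I₂ ⊗ u +ᴹ E ⊗ v)) y z
      ≈⟨ *ᴹ-distribʳ (I₂ ⊗ u +ᴹ E ⊗ v) (I₂ ⊗ W) (E ⊗ 1ᴹ) y z ⟩
    ((I₂ ⊗ W) *ᴹ (I₂ ⊗ u +ᴹ E ⊗ v)) y z + ((E ⊗ 1ᴹ) *ᴹ (I₂ ⊗ u +ᴹ E ⊗ v)) y z
      ≈⟨ +-cong (*ᴹ-distribˡ (I₂ ⊗ W) (I₂ ⊗ u) (E ⊗ v) y z)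
                (*ᴹ-distribˡ (E ⊗ 1ᴹ) (I₂ ⊗ u) (E ⊗ v) y z) ⟩
    (((I₂ ⊗ W) *ᴹ (I₂ ⊗ u)) y z + ((I₂ ⊗ W) *ᴹ (E ⊗ v)) y z) +
    (((E ⊗ 1ᴹ) *ᴹ (I₂ ⊗ u)) y z + ((E ⊗ 1ᴹ) *ᴹ (E ⊗ v)) y z)
      ≈⟨ +-cong
           (+-cong (product (·-identityˡ I₂) ≈ᴹ.refl) (product (·-identityˡ E) ≈ᴹ.refl))
           (+-cong (product (·-identityʳ E) (*ᴹ-identityˡ u)) (product E·E≈E (*ᴹ-identityˡ v))) ⟩
    ((I₂ ⊗ (W *ᴹ u)) y z + (E ⊗ (W *ᴹ v)) y z) + ((E ⊗ u) y z + (E ⊗ v) y z)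
      ≈⟨ +-assoc _ _ _ ⟩
    (I₂ ⊗ (W *ᴹ u) +ᴹ (E ⊗ (W *ᴹ v) +ᴹ (E ⊗ u +ᴹ E ⊗ v))) y z ∎
    where
    open SetoidReasoning setoid
    product : ∀ {M M′ Q N N′ R} → M · M′ ≈₂ Q → N *ᴹ N′ ≈ᴹ R →
              ((M ⊗ N) *ᴹ (M′ ⊗ N′)) y z ≈ (Q ⊗ R) y z
    product {M} {M′} {_} {N} {N′} p q =
      trans (⊗-* M M′ N N′ y z) (⊗-cong p q y z)

  -- Multiply a product of `k` distinct copies by one more copy. If it is already present,
  -- idempotence returns the same product, in `k` ways. Otherwise a product of `k + 1` copies
  -- results, and each of these arises `k + 1` times.
  recurrence : ∀ D k → kroneckerSum E D *ᴹ e E D k ≈ᴹ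
    fromℕ k • e E D k +ᴹ fromℕ (suc k) • e E D (suc k)
  -- The recurrence at `k - 1`. The summand added to both sides turns the coefficient `k - 1` into
  -- `k`, so that `k = 0` fits the same formula.
  recurrence-shifted : ∀ D k → kroneckerSum E D *ᴹ shift (e E D) k +ᴹ shift (e E D) k ≈ᴹ
    fromℕ k • shift (e E D) k +ᴹ fromℕ k • e E D k

  recurrence zero zero y z = trans (*ᴹ-zeroˡ (1ᴹ {0}) y z) (sym (trans
    (+-cong (trans (*-congʳ fromℕ-0) (zeroˡ _)) (zeroʳ _)) (+-identityˡ 0#)))
  recurrence zero (suc k) y z = trans (*ᴹ-zeroˡ (0ᴹ {0}) y z)
    (sym (trans (+-cong (zeroʳ _) (zeroʳ _)) (+-identityˡ 0#)))
  recurrence (suc D) k (a ∷ y) (b ∷ z) = begin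
    (kroneckerSum E (suc D) *ᴹ e E (suc D) k) (a ∷ y) (b ∷ z)
      ≈⟨ kroneckerSum-*-block W u v (a ∷ y) (b ∷ z) ⟩
    δ * (W *ᴹ u) y z + (ε * (W *ᴹ v) y z + (ε * u y z + ε * v y z))
      -- The term `ε * v y z`, which idempotence produced, joins the product with `W` to form the
      -- left side of `recurrence-shifted`.
      ≈⟨ regroup _ _ _ _ _ ⟩
    δ * (W *ᴹ u) y z + (ε * ((W *ᴹ v) y z + v y z) + ε * u y z)
      ≈⟨ +-cong
           (*-congˡ (trans (recurrence D k y z) (+-congˡ (*-congʳ (fromℕ-suc k)))))
           (+-congʳ (*-congˡ (recurrence-shifted D k y z))) ⟩
    δ * (fromℕ k * u y z + (1# + fromℕ k) * w y z) +
    (ε * (fromℕ k * v y z + fromℕ k * u y z) + ε * u y z)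
      ≈⟨ recurrence-suc _ _ _ _ _ _ ⟩
    fromℕ k * (δ * u y z + ε * v y z) + (1# + fromℕ k) * (δ * w y z + ε * u y z)
      ≈⟨ +-congˡ (*-congʳ (fromℕ-suc k)) ⟨
    fromℕ k * (δ * u y z + ε * v y z) + fromℕ (suc k) * (δ * w y z + ε * u y z) ∎
    where
    open SetoidReasoning setoid
    W = kroneckerSum E D
    u = e E D k
    v = shift (e E D) k
    w = e E D (suc k)
    δ = I₂ a b
    ε = E a b

  recurrence-shifted D zero y z = trans
    (+-congʳ (*ᴹ-zeroʳ (kroneckerSum E D) y z))
    (+-cong (sym (zeroʳ _)) (sym (trans (*-congʳ fromℕ-0) (zeroˡ _))))
  recurrence-shifted D (suc k) y z = trans (+-congʳ (recurrence D k y z))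
    (trans (recurrence-shift _ _ _ _) (+-congʳ (*-congʳ (sym (fromℕ-suc k)))))

  module _ {D} {S : Pred (Mat D) 0ℓ} (W∈ : kroneckerSum E D ∈ Subalgebra⟨ S ⟩) where

    -- The recurrence is solved for its last term: subtract `k` times `e E D k`, then divide by
    -- `k + 1`, which is invertible in the complex numbers.
    e∈ : ∀ k → e E D k ∈ Subalgebra⟨ S ⟩
    e∈ zero    = resp (≈ᴹ.sym (e-0 E D)) one
    e∈ (suc k) = resp isolated
      (scal (1/suc k) (add (mul W∈ (e∈ k)) (scal ((- 1#) * fromℕ k) (e∈ k))))
      where
      open SetoidReasoning setoid
      isolated : 1/suc k • (kroneckerSum E D *ᴹ e E D k +ᴹ ((- 1#) * fromℕ k) • e E D k) ≈ᴹ
                 e E D (suc k)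
      isolated y z = begin
        1/suc k * ((kroneckerSum E D *ᴹ e E D k) y z + ((- 1#) * fromℕ k) * e E D k y z)
          ≈⟨ *-congˡ (+-congʳ (recurrence D k y z)) ⟩
        1/suc k * ((fromℕ k * e E D k y z + fromℕ (suc k) * e E D (suc k) y z) +
                   ((- 1#) * fromℕ k) * e E D k y z)
          ≈⟨ isolate _ _ _ _ _ _ ⟩
        (1/suc k * fromℕ (suc k)) * e E D (suc k) y z +
        1/suc k * ((fromℕ k + (- 1#) * fromℕ k) * e E D k y z)
          ≈⟨ +-cong
               (trans (*-congʳ (1/suc-inverse k)) (*-identityˡ _))
               (trans
                 (*-congˡ (trans
                   (*-congʳ (trans (+-congˡ (-1*x≈-x (fromℕ k))) (-‿inverseʳ (fromℕ k))))
                   (zeroˡ _)))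
                 (zeroʳ _)) ⟩
        e E D (suc k) y z + 0#
          ≈⟨ +-identityʳ _ ⟩
        e E D (suc k) y z ∎

    e-partialSum∈ : ∀ s N → e-partialSum E s D N ∈ Subalgebra⟨ S ⟩
    e-partialSum∈ s zero    = e∈ 0
    e-partialSum∈ s (suc N) = add (e-partialSum∈ s N) (scal (s ^ suc N) (e∈ (suc N)))

    [I+sE]^⊗∈ : ∀ s → (I₂ ⊞ s ⋆ E) ^⊗ D ∈ Subalgebra⟨ S ⟩
    [I+sE]^⊗∈ s = resp (e-generating E s ℕ.≤-refl) (e-partialSum∈ s D)

-- From a matrix to its half complement

½ᶜ : ℂ
½ᶜ = fromℚ ½ +i fromℚ 0ℚ

halfComplement : Mat₂ → Mat₂
halfComplement M = ½ᶜ ⋆ (I₂ ⊞ (- 1#) ⋆ M)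

-- Kronecker sums are linear in the matrix, and `I₂` contributes one identity for each of the `D`
-- factors.
kroneckerSum-halfComplement : ∀ M D → kroneckerSum (halfComplement M) D ≈ᴹ
  ½ᶜ • (fromℕ D • 1ᴹ +ᴹ (- 1#) • kroneckerSum M D)
kroneckerSum-halfComplement M zero y z = sym (trans
  (*-congˡ (trans (+-cong (trans (*-congʳ fromℕ-0) (zeroˡ _)) (zeroʳ _)) (+-identityˡ 0#)))
  (zeroʳ _))
kroneckerSum-halfComplement M (suc D) (a ∷ y) (b ∷ z) = trans
  (+-congʳ (*-congˡ (kroneckerSum-halfComplement M D y z)))
  (trans (complement-suc _ _ _ _ _ _ _)
    (*-congˡ (+-congʳ (*-cong (sym (fromℕ-suc D)) (1⊗1 (a ∷ y) (b ∷ z))))))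

kroneckerSum-halfComplement∈ : ∀ {D} {S : Pred (Mat D) 0ℓ} M →
  kroneckerSum M D ∈ Subalgebra⟨ S ⟩ → kroneckerSum (halfComplement M) D ∈ Subalgebra⟨ S ⟩
kroneckerSum-halfComplement∈ {D} M M∈ = resp (≈ᴹ.sym (kroneckerSum-halfComplement M D))
  (scal ½ᶜ (add (scal (fromℕ D) one) (scal (- 1#) M∈)))

-- The generators A and A* as Kronecker sums

X₁ Z₁ : Mat₂
X₁ zero       zero       = 0#
X₁ zero       (suc zero) = 1#
X₁ (suc zero) zero       = 1#
X₁ (suc zero) (suc zero) = 0#
Z₁ zero       zero       = 1#
Z₁ zero       (suc zero) = 0#
Z₁ (suc zero) zero       = 0#
Z₁ (suc zero) (suc zero) = - 1#

~-tail : ∀ {D} a {y z : X D} → (a ∷ y) ~ (a ∷ z) → y ~ z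
~-tail a (zero  , a≢a , _)    = contradiction ≡.refl a≢a
~-tail a (suc k , k≢  , uniq) = k , k≢ , λ h → Fin.suc-injective (uniq h)

~-head : ∀ {D a b} {y z : X D} → a ≢ b → (a ∷ y) ~ (b ∷ z) → y ≡ z
~-head a≢b (zero  , _ , uniq) = lookup-≡ λ k h → Fin.0≢1+n (uniq {suc k} h)
~-head a≢b (suc k , _ , uniq) = contradiction (≡.sym (uniq {zero} a≢b)) Fin.0≢1+n

-- Entries of `A` see the decision only through `does`, so logical equivalence of the two relations
-- suffices.
does-~-≡ : ∀ {D} a (y z : X D) → does ((a ∷ y) ~? (a ∷ z)) ≡ does (y ~? z)
does-~-≡ a y z = does-⇔ (mk⇔ (~-tail a) (~-there a)) ((a ∷ y) ~? (a ∷ z)) (y ~? z)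

does-~-≢ : ∀ {D a b} → a ≢ b → (y z : X D) → does ((a ∷ y) ~? (b ∷ z)) ≡ does (y ≟ˣ z)
does-~-≢ {a = a} {b} a≢b y z = does-⇔
  (mk⇔ (~-head a≢b) (λ { ≡.refl → ~-here y a≢b })) ((a ∷ y) ~? (b ∷ z)) (y ≟ˣ z)

x≈1*x+0*y : ∀ x y → x ≈ 1# * x + 0# * y
x≈1*x+0*y x y = sym (trans (+-cong (*-identityˡ x) (zeroˡ y)) (+-identityʳ x))

y≈0*x+1*y : ∀ x y → y ≈ 0# * x + 1# * y
y≈0*x+1*y x y = sym (trans (+-cong (zeroˡ x) (*-identityˡ y)) (+-identityˡ y))

-- An edge flips either a tail coordinate, keeping the head (the `I₂` block), or the head, keeping
-- the tail (the `X₁` block).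
A≈kroneckerSum : ∀ D → A D ≈ᴹ kroneckerSum X₁ D
A≈kroneckerSum zero    []      []      = refl
A≈kroneckerSum (suc D) (a ∷ y) (b ∷ z) =
  trans (blocks a b) (+-congʳ (*-congˡ (A≈kroneckerSum D y z)))
  where
  blocks : ∀ a b → A (suc D) (a ∷ y) (b ∷ z) ≈ I₂ a b * A D y z + X₁ a b * 1ᴹ y z
  blocks zero       zero       rewrite does-~-≡ zero y z = x≈1*x+0*y _ _
  blocks (suc zero) (suc zero) rewrite does-~-≡ (suc zero) y z = x≈1*x+0*y _ _
  blocks zero       (suc zero) rewrite does-~-≢ {a = zero} {suc zero} (λ ()) y z = y≈0*x+1*y _ _
  blocks (suc zero) zero       rewrite does-~-≢ {a = suc zero} {zero} (λ ()) y z = y≈0*x+1*y _ _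

1+[m-n] : ∀ m n → (+ 1 ℤ.+ m) ℤ.- n ≡ (m ℤ.- n) ℤ.+ + 1
1+[m-n] = solve-∀

[1+m]-[2+n] : ∀ m n → (+ 1 ℤ.+ m) ℤ.- (+ 2 ℤ.+ n) ≡ (m ℤ.- n) ℤ.+ -[1+ 0 ]
[1+m]-[2+n] = solve-∀

-- A new head raises the dimension by 1, and the distance by 1 if it is nonzero. The diagonal entry
-- thus changes by 1 or by 1 - 2 = -1, the diagonal of `Z₁`.
A*≈kroneckerSum : ∀ D → A* D ≈ᴹ kroneckerSum Z₁ D
A*≈kroneckerSum zero    []      []      = fromℕ-0
A*≈kroneckerSum (suc D) (a ∷ y) (b ∷ z) =
  trans (blocks a b) (+-congʳ (*-congˡ (A*≈kroneckerSum D y z)))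
  where
  h = ∂ x₀ y
  diagonal : ∀ i j k {c} t → i ≡ j ℤ.+ k → fromℤ k ≈ c →
    (if t then fromℤ i else 0#) ≈ 1# * (if t then fromℤ j else 0#) + c * (if t then 1# else 0#)
  diagonal i j k true  i≡j+k k≈c = trans (reflexive (≡.cong fromℤ i≡j+k))
    (trans (fromℤ-+ j k) (+-cong (sym (*-identityˡ _)) (trans k≈c (sym (*-identityʳ _)))))
  diagonal i j k false i≡j+k k≈c = sym (trans (+-cong (zeroʳ _) (zeroʳ _)) (+-identityˡ 0#))
  blocks : ∀ a b → A* (suc D) (a ∷ y) (b ∷ z) ≈ I₂ a b * A* D y z + Z₁ a b * 1ᴹ y z
  blocks zero       (suc zero) = sym (trans (+-cong (zeroˡ _) (zeroˡ _)) (+-identityˡ 0#))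
  blocks (suc zero) zero       = sym (trans (+-cong (zeroˡ _) (zeroˡ _)) (+-identityˡ 0#))
  blocks zero       zero       =
    diagonal (+ suc D ℤ.- + (2 ℕ.* h)) (+ D ℤ.- + (2 ℕ.* h)) (+ 1) (does (y ≟ˣ z))
      (1+[m-n] (+ D) (+ (2 ℕ.* h))) fromℤ-1
  blocks (suc zero) (suc zero) =
    diagonal (+ suc D ℤ.- + (2 ℕ.* suc h)) (+ D ℤ.- + (2 ℕ.* h)) -[1+ 0 ] (does (y ≟ˣ z))
      -- Exposes the summand 2 in the doubled distance, so that the integer identity applies.
      (≡.trans (≡.cong (λ n → + suc D ℤ.- + n) (ℕ.*-suc 2 h))
        ([1+m]-[2+n] (+ D) (+ (2 ℕ.* h))))
      fromℤ--1

-- The factorization of `P₁` and its Kronecker power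

halfComplement-X₁-idem : halfComplement X₁ · halfComplement X₁ ≈₂ halfComplement X₁
halfComplement-X₁-idem zero       zero       = ≈-pointwise (λ _ → ≡.refl) (λ _ → ≡.refl)
halfComplement-X₁-idem zero       (suc zero) = ≈-pointwise (λ _ → ≡.refl) (λ _ → ≡.refl)
halfComplement-X₁-idem (suc zero) zero       = ≈-pointwise (λ _ → ≡.refl) (λ _ → ≡.refl)
halfComplement-X₁-idem (suc zero) (suc zero) = ≈-pointwise (λ _ → ≡.refl) (λ _ → ≡.refl)

halfComplement-Z₁-idem : halfComplement Z₁ · halfComplement Z₁ ≈₂ halfComplement Z₁
halfComplement-Z₁-idem zero       zero       = ≈-pointwise (λ _ → ≡.refl) (λ _ → ≡.refl)
halfComplement-Z₁-idem zero       (suc zero) = ≈-pointwise (λ _ → ≡.refl) (λ _ → ≡.refl)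
halfComplement-Z₁-idem (suc zero) zero       = ≈-pointwise (λ _ → ≡.refl) (λ _ → ≡.refl)
halfComplement-Z₁-idem (suc zero) (suc zero) = ≈-pointwise (λ _ → ≡.refl) (λ _ → ≡.refl)

-- If `M` squares to the identity, this acts as 1 and `𝐢` on the eigenspaces of `M` for 1 and -1, so
-- it is a square root of `M`.
factor : Mat₂ → Mat₂
factor M = I₂ ⊞ (𝐢 + - 1#) ⋆ halfComplement M

-- `factor Z₁` is diag(1, i); `factor X₁` has (1 + i)/2 on the diagonal and (1 - i)/2 off it. The
-- scalar 1 - i clears the halves. All entries are constant sequences of closed rationals, so each
-- equation computes.
P₁-factorization : P₁ ≈₂ (1# + - 𝐢) ⋆ (factor X₁ · factor Z₁)
P₁-factorization zero       zero       = ≈-pointwise (λ _ → ≡.refl) (λ _ → ≡.refl)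
P₁-factorization zero       (suc zero) = ≈-pointwise (λ _ → ≡.refl) (λ _ → ≡.refl)
P₁-factorization (suc zero) zero       = ≈-pointwise (λ _ → ≡.refl) (λ _ → ≡.refl)
P₁-factorization (suc zero) (suc zero) = ≈-pointwise (λ _ → ≡.refl) (λ _ → ≡.refl)

factor^⊗∈ : ∀ {D} {S : Pred (Mat D) 0ℓ} M →
  halfComplement M · halfComplement M ≈₂ halfComplement M →
  kroneckerSum M D ∈ Subalgebra⟨ S ⟩ → factor M ^⊗ D ∈ Subalgebra⟨ S ⟩
factor^⊗∈ M idem M∈ =
  Idempotent.[I+sE]^⊗∈ (halfComplement M) idem (kroneckerSum-halfComplement∈ M M∈) (𝐢 + - 1#)

P≈factors : ∀ D → P D ≈ᴹ ((1# + - 𝐢) ^ D) • (factor X₁ ^⊗ D *ᴹ factor Z₁ ^⊗ D)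
P≈factors D = begin
  P D                                                     ≈⟨ P≈P₁^⊗ D ⟩
  P₁ ^⊗ D                                                 ≈⟨ ^⊗-cong P₁-factorization D ⟩
  ((1# + - 𝐢) ⋆ (factor X₁ · factor Z₁)) ^⊗ D             ≈⟨ ^⊗-⋆ _ (factor X₁ · factor Z₁) D ⟩
  ((1# + - 𝐢) ^ D) • ((factor X₁ · factor Z₁) ^⊗ D)
    ≈⟨ (λ y z → *-congˡ (^⊗-· (factor X₁) (factor Z₁) D y z)) ⟩
  ((1# + - 𝐢) ^ D) • (factor X₁ ^⊗ D *ᴹ factor Z₁ ^⊗ D)   ∎
  where open SetoidReasoning (≈ᴹ-setoid D)

lemma7p2 : (D : ℕ) → .{{_ : NonZero D}} → P D ∈ T D
lemma7p2 D = resp (≈ᴹ.sym (P≈factors D)) (scal ((1# + - 𝐢) ^ D) (mul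
  (factor^⊗∈ X₁ halfComplement-X₁-idem (resp (A≈kroneckerSum D) (gen (inj₁ ≡.refl))))
  (factor^⊗∈ Z₁ halfComplement-Z₁-idem (resp (A*≈kroneckerSum D) (gen (inj₂ ≡.refl))))))
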